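{- $C_2=11$. Consequently, $\mathrm{HGP}(B_{2,n})\le 11$ for every $n\ge 1$, and there is an integer $n_0$ with $$n_0\le \lceil 110(\log 2)\,9^7\rceil=364{,}683{,}163$$ ($\log$ the natural logarithm) such that $\mathrm{HGP}(B_{2,n})=11$ for every $n\ge n_0$. In particular, $$\lim_{n\to\infty}\mathrm{HGP}(B_{2,n})=\sup_{n\ge1}\mathrm{HGP}(B_{2,n})=11 .$$
   Context: Proper hat-guessing game: let $G=(V,E)$ be a finite simple graph and $[q]=\{0,1,\dots,q-1\}$. Before play, the vertices agree on deterministic guess functions; the guess of each vertex is a function of the colors on its open neighborhood, with values in $[q]$. An adversary assigns a color from $[q]$ to every vertex so that adjacent vertices get distinct colors (a proper $q$-coloring). All vertices simultaneously guess their own colors. A strategy (family of guess functions) is winning with $q$ colors if for every proper $q$-coloring at least one vertex guesses its own color correctly. The proper hat-guessing number $\mathrm{HGP}(G)$ is the largest $q$ for which a winning strategy exists. The book graph is $B_{k,n}=K_k\vee\overline{K_n}$ (join): $k$ mutually adjacent vertices (spines) and $n$ pairwise nonadjacent vertices (pages), every page adjacent to every spine. A proper $k$-tuple is a $k$-tuple $\boldsymbol{x}=(x_1,\dots,x_k)$ of pairwise distinct colors; a configuration is a set $P$ of proper $k$-tuples, with colors drawn from some finite set. Let $\pi_i(\boldsymbol{x})$ be the $(k-1)$-tuple obtained by deleting coordinate $i$. A set $A$ of proper $k$-tuples is $i$-saturated if $\pi_i$ restricted to $A$ is injective. A configuration $P$ is coverable if it can be partitioned as $P=P_1\,\dot\cup\cdots\dot\cup\,P_k$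 (parts may be empty) with $P_i$ being $i$-saturated for every $i$. Let $\mathrm{supp}(P)=\bigcup_{\boldsymbol{x}\in P}\{x_1,\dots,x_k\}$. Define $$C_k=\min\{|P|+|\mathrm{supp}(P)| : P \text{ is a finite non-coverable configuration of proper } k\text{ -tuples}\},$$ where the colors may be drawn from any finite set. Here $k=2$. -}

module Defs where

open import Level using (Level; 0ℓ)
open import Data.Empty using (⊥)
open import Data.Fin using (Fin; splitAt; _≟_)
open import Data.Fin.Subset using (Subset; ⁅_⁆; ⋃) renaming (∣_∣ to card)
open import Data.Integer using (ℤ; +_)
open import Data.List using (List; length)
import Data.List as List
open import Data.List.Membership.Propositional using (_∈_)
open import Data.List.Relation.Unary.All using (All)
open import Data.List.Relation.Unary.Unique.Propositional using (Unique)
open import Data.Nat using (ℕ; zero; suc; pred; _≤_; _≥_; _+_; _!)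
open import Data.Nat.Properties using (_!≢0)
open import Data.Product using (Σ; Σ-syntax; ∃-syntax; _×_; _,_)
open import Data.Rational as ℚ using (ℚ)
open import Data.Rational.Properties using (+-*-commutativeRing)
open import Data.Sum using (_⊎_; inj₁; inj₂)
open import Data.Unit using (⊤; tt)
open import Data.Vec using (Vec; toList; removeAt)
import Data.Vec.Relation.Unary.Unique.Propositional as Vec
open import Algebra.Bundles using (CommutativeRing)
open import Algebra.Properties.Semiring.Exp (CommutativeRing.semiring +-*-commutativeRing) using (_^_)
open import Relation.Binary using (Rel; Symmetric; Irreflexive; Decidable)
open import Relation.Binary.PropositionalEquality using (_≡_; _≢_; refl; sym)
open import Relation.Nullary using (¬_; yes; no)
open import Relation.Nullary.Decidable using (¬?)

IsMinimum IsMaximum : ∀ {ℓ : Level} → (ℕ → Set ℓ) → ℕ → Set ℓ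
IsMinimum P m = P m × (∀ n → P n → m ≤ n)
IsMaximum P m = P m × (∀ n → P n → n ≤ m)

record Graph : Set₁ where
  field
    order  : ℕ
  Vertex : Set
  Vertex = Fin order
  field
    _~_    : Rel Vertex 0ℓ
    ~-sym  : Symmetric _~_
    ~-irr  : Irreflexive _≡_ _~_
    _~?_   : Decidable _~_

complete : ℕ → Graph
complete n = record
  { order = n
  ; _~_   = _≢_
  ; ~-sym = λ i≢j j≡i → i≢j (sym j≡i)
  ; ~-irr = λ i≡j i≢j → i≢j i≡j
  ; _~?_  = λ i j → ¬? (i ≟ j)
  }

edgeless : ℕ → Graph
edgeless n = record
  { order = n
  ; _~_   = λ _ _ → ⊥
  ; ~-sym = λ ()
  ; ~-irr = λ _ ()
  ; _~?_  = λ _ _ → no λ ()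
  }

-- The first `order G` vertices of `join G H` are those of G, the others
-- those of H.
module Join (G H : Graph) where
  private
    module G = Graph G
    module H = Graph H

  _~⊎_ : Rel (G.Vertex ⊎ H.Vertex) 0ℓ
  inj₁ u ~⊎ inj₁ v = u G.~ v
  inj₁ _ ~⊎ inj₂ _ = ⊤
  inj₂ _ ~⊎ inj₁ _ = ⊤
  inj₂ u ~⊎ inj₂ v = u H.~ v

  ~⊎-sym : Symmetric _~⊎_
  ~⊎-sym {inj₁ _} {inj₁ _} e = G.~-sym e
  ~⊎-sym {inj₁ _} {inj₂ _} _ = tt
  ~⊎-sym {inj₂ _} {inj₁ _} _ = tt
  ~⊎-sym {inj₂ _} {inj₂ _} e = H.~-sym e

  ~⊎-irr : Irreflexive _≡_ _~⊎_
  ~⊎-irr {inj₁ _} refl e = G.~-irr refl e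
  ~⊎-irr {inj₂ _} refl e = H.~-irr refl e

  _~⊎?_ : Decidable _~⊎_
  inj₁ u ~⊎? inj₁ v = u G.~? v
  inj₁ _ ~⊎? inj₂ _ = yes tt
  inj₂ _ ~⊎? inj₁ _ = yes tt
  inj₂ u ~⊎? inj₂ v = u H.~? v

  join : Graph
  join = record
    { order = G.order + H.order
    ; _~_   = λ u v → splitAt G.order u ~⊎ splitAt G.order v
    ; ~-sym = λ {u} {v} → ~⊎-sym {splitAt G.order u} {splitAt G.order v}
    ; ~-irr = λ { {u} refl → ~⊎-irr {splitAt G.order u} refl }
    ; _~?_  = λ u v → splitAt G.order u ~⊎? splitAt G.order v
    }

open Join public using (join)

book : ℕ → ℕ → Graph
book k n = join (complete k) (edgeless n)

module _ (G : Graph) where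
  open Graph G

  Coloring : ℕ → Set
  Coloring q = Vertex → Fin q

  Proper : ∀ {q} → Coloring q → Set
  Proper c = ∀ u v → u ~ v → c u ≢ c v

  -- A function of the colors on the open neighborhood of v is given as a
  -- function of whole colorings (proper or not) that depends only on their
  -- values at the neighbors of v.
  record Strategy (q : ℕ) : Set where
    field
      guess : Vertex → Coloring q → Fin q
      local : ∀ v (c d : Coloring q) → (∀ u → u ~ v → c u ≡ d u) →
              guess v c ≡ guess v d

  Winning : ∀ {q} → Strategy q → Set
  Winning {q} s = ∀ (c : Coloring q) → Proper c → ∃[ v ] Strategy.guess s v c ≡ c v

  -- HGP(G) = h
  IsHGP : ℕ → Set
  IsHGP = IsMaximum λ q → Σ[ s ∈ Strategy q ] Winning s

Tuple : ℕ → ℕ → Set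
Tuple m k = Vec (Fin m) k

π : ∀ {m k} → Fin k → Tuple m k → Tuple m (pred k)
π {k = suc _} i x = removeAt x i

-- A finite set of proper k-tuples with colors in Fin m, as a list without
-- repetitions.
record Configuration (m k : ℕ) : Set where
  field
    tuples : List (Tuple m k)
    unique : Unique tuples
    proper : All Vec.Unique tuples

  size : ℕ
  size = length tuples

  supp : Subset m
  supp = ⋃ (List.map (λ x → ⋃ (List.map ⁅_⁆ (toList x))) tuples)

open Configuration using (tuples; size; supp)

Saturated : ∀ {m k} → Fin k → (Tuple m k → Set) → Set
Saturated i A = ∀ x y → A x → A y → π i x ≡ π i y → x ≡ y

-- The partition P = P₁ ∪ ⋯ ∪ P_k is given by the map sending each tuple of P
-- to the index of its part.
Coverable : ∀ {m k} → Configuration m k → Set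
Coverable {m} {k} P =
  Σ[ part ∈ (Tuple m k → Fin k) ]
    ∀ i → Saturated i (λ x → x ∈ tuples P × part x ≡ i)

-- C_k = c
IsC : ℕ → ℕ → Set
IsC k = IsMinimum λ c →
  ∃[ m ] Σ[ P ∈ Configuration m k ] (¬ Coverable P × size P + card (supp P) ≡ c)

fromℕ : ℕ → ℚ
fromℕ n = + n ℚ./ 1

IsLimit : (ℕ → ℕ) → ℕ → Set
IsLimit a l = ∀ (ε : ℚ) → ε ℚ.> ℚ.0ℚ →
  ∃[ N ] ∀ n → n ≥ N → ℚ.∣ fromℕ (a n) ℚ.- fromℕ l ∣ ℚ.< ε

-- l = sup_{n ≥ 1} a n
IsSup≥1 : (ℕ → ℕ) → ℕ → Set
IsSup≥1 a l = (∀ n → n ≥ 1 → a n ≤ l) × (∀ b → (∀ n → n ≥ 1 → a n ≤ b) → l ≤ b)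

-- A real number r is represented by its lower cut { q ∈ ℚ | q < r }.
Real : Set₁
Real = ℚ → Set

-- lim s < y, for a convergent sequence s
Lim_<_ : (ℕ → ℚ) → ℚ → Set
Lim s < y = ∃[ ε ] (ε ℚ.> ℚ.0ℚ × ∃[ N ] ∀ n → n ≥ N → s n ℚ.+ ε ℚ.≤ y)

-- The n-th partial sum Σ_{j<n} qʲ/j! of the exponential series.
expSum : ℚ → ℕ → ℚ
expSum q zero    = ℚ.0ℚ
expSum q (suc n) = expSum q n ℚ.+ (q ^ n) ℚ.* ((+ 1 ℚ./ (n !)) {{n !≢0}})

-- For y > 0, log is the inverse of exp, so q < log y iff exp q < y.
log : ℚ → Real
log y q = Lim expSum q < y

-- For a > 0, q < a r iff q ≤ a p for some rational p < r.
_·_ : ℚ → Real → Real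
(a · r) q = ∃[ p ] (r p × q ℚ.≤ a ℚ.* p)

-- N = ⌈r⌉ iff N - 1 < r and r ≤ N, the latter being the negation of N < r.
IsCeiling : Real → ℤ → Set
IsCeiling r N = r ((N Data.Integer.- + 1) ℚ./ 1) × ¬ r (N ℚ./ 1)

{-# OPTIONS --safe #-}
module Submission where

-- For K₂ the deletion of a coordinate turns a tuple into an arc whose head
-- (part 0) or tail (part 1) must be unique in its part, so a configuration is a
-- bipartite graph between tails and heads to be oriented with in-degrees at most
-- one.  Removing arcs with an unshared end leaves only the 4-cycle when there are
-- at most five arcs; K₂₃ is the smallest obstruction, on five colors, and on at
-- most four colors (where K₂₃ does not embed) six arcs can always be covered.
--
-- With 12 or more colors the pages can avoid being right on K₂₃.  With 11
-- colors, assign one page to each pair of a set D of d ≤ 7 colors and a set S of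
-- d arcs on the other colors, and let it guess bijectively from S to D.  When
-- the pages show exactly the colors of D, fewer than d arcs can survive, and
-- these are covered by the spines; and if they show more than 7 colors, at most
-- three are left to the arcs.  The number of such pairs, counting loops as arcs,
-- is Σ_d C(11,d) C((11-d)²,d) = 336738644.

open import Algebra.Bundles using (CommutativeRing)
open import Defs
open import Data.Bool using (Bool; true; T; _∧_; _∨_)
open import Data.Bool.Properties using (T-∧; T-∨)
open import Data.Empty using (⊥; ⊥-elim)
open import Data.Fin as Fin using (Fin; zero; suc; #_; finToFun; funToFin)
open import Data.Fin.Properties as Fin using (any?; all?; pigeonhole; inject≤-injective; ¬∀⟶∃¬; finToFun-funToFin)
open import Data.Fin.Subset using (Subset; inside; outside; ⋃; ⁅_⁆) renaming (_∈_ to _∈ˢ_; ∣_∣ to card)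
open import Data.Fin.Subset.Properties using (x∈p∪q⁺; x∈⁅x⁆)
open import Data.Integer using (+_)
import Data.Integer as ℤ
import Data.Integer.Properties as ℤ
open import Data.List using (List; []; _∷_; _++_; length; map; lookup; filter; concatMap; cartesianProduct; allFin; upTo; applyUpTo; take)
import Data.List.Membership.DecPropositional as DecMembership
open import Data.List.Membership.Propositional using (_∈_; _∉_; find; lose)
open import Data.List.Membership.Propositional.Properties
open import Data.List.Properties using (filter-notAll; length-map; length-++; length-take; length-tabulate)
open import Data.List.Relation.Binary.Sublist.Propositional using ([]; _∷_; _∷ʳ_) renaming (_⊆_ to _⊑_; lookup to ⊑-lookup; ⊆-trans to ⊑-trans)
open import Data.List.Relation.Binary.Sublist.Propositional.Properties using (filter-⊆; take-⊆)
open import Data.List.Relation.Binary.Subset.Propositional using (_⊆_)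
open import Data.List.Relation.Unary.All as All using (All; []; _∷_)
import Data.List.Relation.Unary.All.Properties as All
open import Data.List.Relation.Unary.AllPairs using (AllPairs; []; _∷_)
open import Data.List.Relation.Unary.Any as Any using (Any; here; there)
open import Data.List.Relation.Unary.Any.Properties using (lookup-index)
import Data.List.Relation.Unary.Unique.DecPropositional as DecUnique
open import Data.List.Relation.Unary.Unique.Propositional using (Unique)
import Data.List.Relation.Unary.Unique.Propositional.Properties as Unique
open import Data.Nat using (ℕ; _≤_; _≥_; _*_; _^_)
open import Data.Nat as ℕ using (zero; suc; _<_; z≤n; s≤s; _+_; _!)
open import Data.Nat.Combinatorics using (_C_; nCk+nC[k+1]≡[n+1]C[k+1])
open import Data.Nat.ListAction using (sum)
open import Data.Nat.Properties as ℕ using (_!≢0)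
open import Data.Product using (Σ-syntax; ∃-syntax; _×_; _,_; proj₁; proj₂)
open import Data.Product.Properties using (≡-dec)
open import Data.Rational as ℚ using (ℚ; 0ℚ; 1ℚ; NonNegative)
import Data.Rational.Properties as ℚ
open import Algebra.Properties.Semiring.Exp (CommutativeRing.semiring ℚ.+-*-commutativeRing) using () renaming (_^_ to _^ℚ_)
open import Data.Rational.Unnormalised as ℚᵘ using (mkℚᵘ)
import Data.Rational.Unnormalised.Properties as ℚᵘ
open import Data.Sum using (_⊎_; inj₁; inj₂; [_,_])
open import Data.Unit using (tt)
open import Data.Vec using (Vec; []; _∷_; tabulate)
import Data.Vec as Vec
open import Data.Vec.Properties using (∷-injectiveˡ; tabulate-cong; lookup∘tabulate) renaming (≡-dec to vec-≡-dec)
import Data.Vec.Relation.Unary.All as VecAll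
import Data.Vec.Relation.Unary.AllPairs as VecAllPairs
open import Function using (_∘_; id; Equivalence; Injective)
open import Relation.Binary using (DecidableEquality)
open import Relation.Binary.PropositionalEquality using (_≡_; _≢_; refl; sym; trans; cong; cong₂; subst; subst₂; ≢-sym)
open import Relation.Nullary using (¬_; Dec; yes; no; contradiction)
open import Relation.Nullary.Decidable using (¬?; _→-dec_; _×-dec_; isYes; toWitness; T?; map′; decidable-stable)

-- Covering arcs

module _ {A : Set} (_≟_ : DecidableEquality A) where

  unique-⊆⇒length≤ : ∀ {xs ys : List A} → Unique xs → xs ⊆ ys → length xs ≤ length ys
  unique-⊆⇒length≤ {[]} _ _ = z≤n
  unique-⊆⇒length≤ {x ∷ xs} {ys} (x∉xs ∷ uxs) xs⊆ys = ℕ.≤-trans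
    (s≤s (unique-⊆⇒length≤ uxs λ z∈xs →
      ∈-filter⁺ ≢x? (xs⊆ys (there z∈xs)) (≢-sym (All.lookup x∉xs z∈xs))))
    (filter-notAll ≢x? ys (Any.map (λ { refl x≢x → x≢x refl }) (xs⊆ys (here refl))))
    where
    ≢x? = λ z → ¬? (z ≟ x)

module _ {A : Set} where

  combinations : ℕ → List A → List (List A)
  combinations zero    _        = [] ∷ []
  combinations (suc k) []       = []
  combinations (suc k) (x ∷ xs) = map (x ∷_) (combinations k xs) ++ combinations (suc k) xs

  ∈-combinations : ∀ {xs ys : List A} → xs ⊑ ys → xs ∈ combinations (length xs) ys
  ∈-combinations []                        = here refl
  ∈-combinations {[]}     (_ ∷ʳ _)         = here refl
  ∈-combinations {x ∷ xs} {y ∷ ys} (y ∷ʳ xs⊑ys) =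
    ∈-++⁺ʳ (map (y ∷_) (combinations (length xs) ys)) (∈-combinations xs⊑ys)
  ∈-combinations {x ∷ xs} (refl ∷ xs⊑ys)   = ∈-++⁺ˡ (∈-map⁺ (x ∷_) (∈-combinations xs⊑ys))

  length-combinations : ∀ k (xs : List A) → length (combinations k xs) ≡ length xs C k
  length-combinations zero    xs       = refl
  length-combinations (suc k) []       = refl
  length-combinations (suc k) (x ∷ xs) = trans
    (length-++ (map (x ∷_) (combinations k xs)))
    (trans
      (cong₂ _+_ (trans (length-map (x ∷_) (combinations k xs)) (length-combinations k xs))
                 (length-combinations (suc k) xs))
      (nCk+nC[k+1]≡[n+1]C[k+1] (length xs) k))

Arc : Set → Set
Arc C = C × C

-- The coordinate of an arc that remains when the given one is deleted.
end : ∀ {C} → Fin 2 → Arc C → C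
end zero       = proj₂
end (suc zero) = proj₁

-- Only membership in the list counts, so repeated arcs are harmless and a covering of a larger list
-- serves every list contained in it.
Covered : ∀ {C} → List (Arc C) → Set
Covered {C} P = Σ[ part ∈ (Arc C → Fin 2) ]
  ∀ i {u v} → u ∈ P → v ∈ P → part u ≡ i → part v ≡ i → end i u ≡ end i v → u ≡ v

Separated : ∀ {C} → Fin 2 → List (Arc C) → Set
Separated i = AllPairs λ u v → end i u ≢ end i v

separated-injective : ∀ {C} i {P : List (Arc C)} → Separated i P →
                      ∀ {u v} → u ∈ P → v ∈ P → end i u ≡ end i v → u ≡ v
separated-injective i sep u∈P v∈P eq with ∈-AllPairs₂ sep u∈P v∈P
... | inj₁ u≡v        = u≡v
... | inj₂ (inj₁ u≢v) = contradiction eq u≢v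
... | inj₂ (inj₂ v≢u) = contradiction (sym eq) v≢u

-- A covering pulls back along `f`: arcs that share an end still share it after renaming, so
-- saturation makes their images equal. Injectivity is needed only among tails and among heads,
-- since a tail is never compared with a head.
relabel : ∀ {C D} (f : C → D) {P : List (Arc C)} →
          (∀ {a b c d} → (a , b) ∈ P → (c , d) ∈ P →
            (f a ≡ f c → a ≡ c) × (f b ≡ f d → b ≡ d)) →
          Covered (map (λ (a , b) → f a , f b) P) → Covered P
relabel f {P} inj (part , sat) = part ∘ f² , λ where
    zero       u∈P v∈P pu pv eq → injective u∈P v∈P (sat zero (∈-map⁺ f² u∈P) (∈-map⁺ f² v∈P) pu pv (cong f eq))
    (suc zero) u∈P v∈P pu pv eq → injective u∈P v∈P (sat (suc zero) (∈-map⁺ f² u∈P) (∈-map⁺ f² v∈P) pu pv (cong f eq))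
  where
  f² = λ (a , b) → f a , f b
  injective : ∀ {u v} → u ∈ P → v ∈ P → f² u ≡ f² v → u ≡ v
  injective u∈P v∈P eq = cong₂ _,_ (proj₁ (inj u∈P v∈P) (cong proj₁ eq)) (proj₂ (inj u∈P v∈P) (cong proj₂ eq))

module Covering {C : Set} (_≟_ : DecidableEquality C) where

  _≟²_ : DecidableEquality (Arc C)
  _≟²_ = ≡-dec _≟_ _≟_

  open DecMembership _≟²_ using (_∈?_)

  -- The two lists may overlap. Arcs of `L` go to part 0, and an arc of `P` outside `L` must lie in
  -- `R`.
  covered-split : ∀ {P L R} → Separated zero L → Separated (suc zero) R → P ⊆ L ++ R → Covered P
  covered-split {P} {L} {R} sepL sepR P⊆L++R = part , sat
    where
    part : Arc C → Fin 2
    part u with u ∈? L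
    ... | yes _ = zero
    ... | no  _ = suc zero

    ∈L : ∀ u → part u ≡ zero → u ∈ L
    ∈L u eq with u ∈? L
    ... | yes u∈L = u∈L

    ∈R : ∀ u → u ∈ P → part u ≡ suc zero → u ∈ R
    ∈R u u∈P eq with u ∈? L
    ... | no u∉L = [ (λ u∈L → contradiction u∈L u∉L) , id ] (∈-++⁻ L (P⊆L++R u∈P))

    sat : ∀ i {u v} → u ∈ P → v ∈ P → part u ≡ i → part v ≡ i → end i u ≡ end i v → u ≡ v
    sat zero       {u} {v} u∈P v∈P pu pv = separated-injective zero sepL (∈L u pu) (∈L v pv)
    sat (suc zero) {u} {v} u∈P v∈P pu pv = separated-injective (suc zero) sepR (∈R u u∈P pu) (∈R v v∈P pv)

  Fresh : Fin 2 → Arc C → List (Arc C) → Set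
  Fresh i u = All λ v → end i u ≢ end i v

  fresh? : ∀ i u L → Dec (Fresh i u L)
  fresh? i u = All.all? λ v → ¬? (end i u ≟ end i v)

  -- Backtracking over all assignments of arcs to the two parts; a branch is cut as soon as the end
  -- that has to be unique is already taken.
  search : List (Arc C) → List (Arc C) → List (Arc C) → Bool
  search L R []      = true
  search L R (u ∷ S) = (isYes (fresh? zero u L) ∧ search (u ∷ L) R S)
                     ∨ (isYes (fresh? (suc zero) u R) ∧ search L (u ∷ R) S)

  -- The search returns only a Boolean. Accumulators never shrink along a branch, so those at the
  -- end of a successful branch contain every arc placed on the way.
  search-sound : ∀ {L R} S → Separated zero L → Separated (suc zero) R → T (search L R S) →
                 ∃[ L′ ] ∃[ R′ ] Separated zero L′ × Separated (suc zero) R′ ×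
                   L ⊆ L′ × R ⊆ R′ × S ⊆ L′ ++ R′
  search-sound [] sepL sepR _ = _ , _ , sepL , sepR , id , id , λ ()
  search-sound {L} {R} (u ∷ S) sepL sepR ok
    with Equivalence.to (T-∨ {isYes (fresh? zero u L) ∧ search (u ∷ L) R S}) ok
  ... | inj₁ ok₁
    with fresh , ok₂ ← Equivalence.to (T-∧ {isYes (fresh? zero u L)}) ok₁
    with L′ , R′ , sepL′ , sepR′ , L⊆ , R⊆ , S⊆ ← search-sound S (toWitness {a? = fresh? zero u L} fresh ∷ sepL) sepR ok₂
    = L′ , R′ , sepL′ , sepR′ , (λ m → L⊆ (there m)) , R⊆ ,
      λ { (here refl) → ∈-++⁺ˡ (L⊆ (here refl)) ; (there m) → S⊆ m }
  ... | inj₂ ok₁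
    with fresh , ok₂ ← Equivalence.to (T-∧ {isYes (fresh? (suc zero) u R)}) ok₁
    with L′ , R′ , sepL′ , sepR′ , L⊆ , R⊆ , S⊆ ← search-sound S sepL (toWitness {a? = fresh? (suc zero) u R} fresh ∷ sepR) ok₂
    = L′ , R′ , sepL′ , sepR′ , L⊆ , (λ m → R⊆ (there m)) ,
      λ { (here refl) → ∈-++⁺ʳ L′ (R⊆ (here refl)) ; (there m) → S⊆ m }

  search⇒covered : ∀ {P} S → T (search [] [] S) → P ⊆ S → Covered P
  search⇒covered S ok P⊆S
    with L , R , sepL , sepR , _ , _ , S⊆ ← search-sound S [] [] ok
    = covered-split sepL sepR λ m → S⊆ (P⊆S m)

  Lonely : Fin 2 → Arc C → List (Arc C) → Set
  Lonely i a = All λ b → end i b ≡ end i a → b ≡ a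

  lonely? : ∀ i a P → Dec (Lonely i a P)
  lonely? i a = All.all? λ b → (end i b ≟ end i a) →-dec (b ≟² a)

  -- An arc that does not share its i-th end with another one can go to part i.
  covered-extend : ∀ i a {P} → Lonely i a P →
                   Covered (filter (λ b → ¬? (b ≟² a)) P) → Covered P
  covered-extend i a {P} lonely (part , sat) = part′ , sat′
    where
    ≢a? = λ b → ¬? (b ≟² a)
    part′ : Arc C → Fin 2
    part′ b with b ≟² a
    ... | yes _ = i
    ... | no  _ = part b

    sat′ : ∀ j {u v} → u ∈ P → v ∈ P → part′ u ≡ j → part′ v ≡ j → end j u ≡ end j v → u ≡ v
    sat′ j {u} {v} u∈P v∈P pu pv eq with u ≟² a | v ≟² a
    ... | yes refl | yes refl = refl
    sat′ j u∈P v∈P refl pv eq | yes refl | no _ = sym (All.lookup lonely v∈P (sym eq))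
    sat′ j u∈P v∈P pu refl eq | no _ | yes refl = All.lookup lonely u∈P eq
    ... | no u≢a | no v≢a = sat j (∈-filter⁺ ≢a? u∈P u≢a) (∈-filter⁺ ≢a? v∈P v≢a) pu pv eq

  Partner : Fin 2 → Arc C → List (Arc C) → Set
  Partner i a P = ∃[ b ] b ∈ P × end i b ≡ end i a × b ≢ a

  partner? : ∀ i P → (∃[ a ] a ∈ P × Lonely i a P) ⊎ (∀ {a} → a ∈ P → Partner i a P)
  partner? i P with Any.any? (λ a → lonely? i a P) P
  ... | yes some = inj₁ (find some)
  ... | no  none = inj₂ partner
    where
    partner : ∀ {a} → a ∈ P → Partner i a P
    partner {a} a∈P
      with b , b∈P , ¬impl ← find (All.¬All⇒Any¬ (λ b → (end i b ≟ end i a) →-dec (b ≟² a)) P λ alone →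
             none (Any.map (λ { refl → alone }) a∈P))
      with end i b ≟ end i a
    ... | yes eq = b , b∈P , eq , λ b≡a → ¬impl λ _ → b≡a
    ... | no neq = contradiction (λ eq → contradiction eq neq) ¬impl

  -- With at most five arcs, the only nonempty graph in which every arc shares
  -- both its ends with other arcs is the 4-cycle.
  covered-core : ∀ P → length P ≤ 5 → (∀ i {a} → a ∈ P → Partner i a P) → Covered P
  covered-core [] _ _ = (λ _ → zero) , λ _ ()
  covered-core P@((a , b) ∷ _) ∣P∣≤5 partner
    -- Walk both ways from x = (a , b): y = (a , b′) and z = (a′ , b) share its tail and its head,
    -- then w = (a″ , b′) shares the head of y and v = (a′ , b″) the tail of z. Either w and v
    -- coincide and close a 4-cycle, or these are five distinct arcs.
    with (_ , b′) , y∈P , refl , y≢x ← partner (suc zero) (here refl)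
    with (a′ , _) , z∈P , refl , z≢x ← partner zero (here refl)
    with (a″ , _) , w∈P , refl , w≢y ← partner zero y∈P
    with (_ , b″) , v∈P , refl , v≢z ← partner (suc zero) z∈P
    = cover
    where
    x∈P : (a , b) ∈ P
    x∈P = here refl
    limit : ∀ {us} → Unique us → us ⊆ P → length us ≤ 5
    limit uus us⊆P = ℕ.≤-trans (unique-⊆⇒length≤ _≟²_ uus us⊆P) ∣P∣≤5
    exhaust : ∀ {us} → length us ≡ 5 → Unique us → All (_∈ P) us → P ⊆ us
    exhaust {us} len uus us⊆P {u} u∈P with u ∈? us
    ... | yes u∈us = u∈us
    ... | no  u∉us = contradiction
      (limit (All.¬Any⇒All¬ us u∉us ∷ uus) (λ { (here refl) → u∈P ; (there m) → All.lookup us⊆P m }))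
      (λ ∣us∣<5 → ℕ.<-irrefl len ∣us∣<5)
    b≢b′ : b ≢ b′
    b≢b′ refl = y≢x refl
    a≢a′ : a ≢ a′
    a≢a′ refl = z≢x refl
    a≢a″ : a ≢ a″
    a≢a″ refl = w≢y refl
    b≢b″ : b ≢ b″
    b≢b″ refl = v≢z refl
    ≢₁ : ∀ {c d e f : C} → c ≢ e → (c , d) ≢ (e , f)
    ≢₁ c≢e refl = c≢e refl
    ≢₂ : ∀ {c d e f : C} → d ≢ f → (c , d) ≢ (e , f)
    ≢₂ d≢f refl = d≢f refl

    -- Five distinct arcs fill `P`. The partner of v at its head then forces b″ = b′ and the partner
    -- of w at its tail forces a″ = a′, so w and v are equal after all.
    five : (a″ , b′) ≢ (a′ , b″) → ⊥
    five w≢v = w≢v (cong₂ _,_ a″≡a′ (sym b″≡b′))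
      where
      all-of-P : P ⊆ (a , b) ∷ (a , b′) ∷ (a′ , b) ∷ (a″ , b′) ∷ (a′ , b″) ∷ []
      all-of-P = exhaust refl
        ( (≢₂ b≢b′ ∷ ≢₁ a≢a′ ∷ ≢₁ a≢a″ ∷ ≢₁ a≢a′ ∷ [])
        ∷ (≢₁ a≢a′ ∷ ≢₁ a≢a″ ∷ ≢₁ a≢a′ ∷ [])
        ∷ (≢₂ b≢b′ ∷ ≢₂ b≢b″ ∷ [])
        ∷ (w≢v ∷ []) ∷ [] ∷ [])
        (x∈P ∷ y∈P ∷ z∈P ∷ w∈P ∷ v∈P ∷ [])
      b″≡b′ : b″ ≡ b′
      b″≡b′ with u , u∈P , eq , u≢v ← partner zero v∈P with all-of-P u∈P
      ... | here refl = contradiction eq b≢b″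
      ... | there (here refl) = sym eq
      ... | there (there (here refl)) = contradiction eq b≢b″
      ... | there (there (there (here refl))) = sym eq
      ... | there (there (there (there (here refl)))) = contradiction refl u≢v
      a″≡a′ : a″ ≡ a′
      a″≡a′ with u , u∈P , eq , u≢w ← partner (suc zero) w∈P with all-of-P u∈P
      ... | here refl = contradiction eq a≢a″
      ... | there (here refl) = contradiction eq a≢a″
      ... | there (there (here refl)) = sym eq
      ... | there (there (there (here refl))) = contradiction refl u≢w
      ... | there (there (there (there (here refl)))) = sym eq

    cycle = (a , b) ∷ (a′ , b′) ∷ (a , b′) ∷ (a′ , b) ∷ []

    -- An arc `u` off the cycle would be the fifth and last one. Its partners then lie on the cycle,
    -- so its tail is a or a′ and its head b or b′; but all four such arcs are on the cycle.
    four : (a″ , b′) ≡ (a′ , b″) → P ⊆ cycle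
    four refl {u} u∈P with u ∈? cycle
    ... | yes m = m
    ... | no u∉
      with all-of-P ← (λ {t} → exhaust {u ∷ cycle} refl
             ( All.¬Any⇒All¬ _ u∉
             ∷ (≢₁ a≢a′ ∷ ≢₂ b≢b′ ∷ ≢₁ a≢a′ ∷ [])
             ∷ (≢₁ (≢-sym a≢a′) ∷ ≢₂ (≢-sym b≢b′) ∷ [])
             ∷ (≢₁ a≢a′ ∷ []) ∷ [] ∷ [])
             (u∈P ∷ x∈P ∷ w∈P ∷ y∈P ∷ z∈P ∷ []) {t})
      with s , s∈P , eqs , s≢u ← partner zero u∈P
      with t , t∈P , eqt , t≢u ← partner (suc zero) u∈P
      with all-of-P s∈P | all-of-P t∈P
    ... | here refl | _ = contradiction refl s≢u
    ... | there _ | here refl = contradiction refl t≢u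
    ... | there s∈ | there t∈ = ⊥-elim (u∉ (grid {u} (ends₁ t∈ eqt) (ends₂ s∈ eqs)))
      where
      ends₁ : ∀ {t} → t ∈ cycle → proj₁ t ≡ proj₁ u → proj₁ u ≡ a ⊎ proj₁ u ≡ a′
      ends₁ (here refl) eq = inj₁ (sym eq)
      ends₁ (there (here refl)) eq = inj₂ (sym eq)
      ends₁ (there (there (here refl))) eq = inj₁ (sym eq)
      ends₁ (there (there (there (here refl)))) eq = inj₂ (sym eq)
      ends₂ : ∀ {t} → t ∈ cycle → proj₂ t ≡ proj₂ u → proj₂ u ≡ b ⊎ proj₂ u ≡ b′
      ends₂ (here refl) eq = inj₁ (sym eq)
      ends₂ (there (here refl)) eq = inj₂ (sym eq)
      ends₂ (there (there (here refl))) eq = inj₂ (sym eq)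
      ends₂ (there (there (there (here refl)))) eq = inj₁ (sym eq)
      grid : ∀ {u} → proj₁ u ≡ a ⊎ proj₁ u ≡ a′ → proj₂ u ≡ b ⊎ proj₂ u ≡ b′ → u ∈ cycle
      grid (inj₁ refl) (inj₁ refl) = here refl
      grid (inj₂ refl) (inj₂ refl) = there (here refl)
      grid (inj₁ refl) (inj₂ refl) = there (there (here refl))
      grid (inj₂ refl) (inj₁ refl) = there (there (there (here refl)))

    cover : Covered P
    cover with (a″ , b′) ≟² (a′ , b″)
    ... | no w≢v  = ⊥-elim (five w≢v)
    -- The 4-cycle splits into its two perfect matchings, one for each part.
    ... | yes w≡v = covered-split {L = (a , b) ∷ (a′ , b′) ∷ []} {R = (a , b′) ∷ (a′ , b) ∷ []}
      ((b≢b′ ∷ []) ∷ [] ∷ []) ((a≢a′ ∷ []) ∷ [] ∷ []) (four w≡v)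

  -- Arcs with an unshared end are peeled off one by one and put back by `covered-extend`; when none
  -- is left to peel, `covered-core` applies. The bound `n` on the length makes the recursion
  -- terminate.
  covered-≤5 : ∀ P → length P ≤ 5 → Covered P
  covered-≤5 P ∣P∣≤5 = go (length P) P ℕ.≤-refl ∣P∣≤5
    where
    go : ∀ n P → length P ≤ n → length P ≤ 5 → Covered P
    peel : ∀ n P → length P ≤ n → length P ≤ 5 → ∀ i a → a ∈ P →
           Lonely i a P → Covered P
    peel zero    []  _ _ i a ()
    peel (suc n) P ∣P∣≤1+n ∣P∣≤5 i a a∈P alone = covered-extend i a alone
      (go n _ (ℕ.s≤s⁻¹ (ℕ.≤-trans shorter ∣P∣≤1+n)) (ℕ.≤-trans (ℕ.<⇒≤ shorter) ∣P∣≤5))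
      where
      shorter = filter-notAll (λ b → ¬? (b ≟² a)) P (Any.map (λ { refl x≢x → x≢x refl }) a∈P)
    go n P ∣P∣≤n ∣P∣≤5 with partner? zero P
    ... | inj₁ (a , a∈P , alone) = peel n P ∣P∣≤n ∣P∣≤5 zero a a∈P alone
    ... | inj₂ partner₀ with partner? (suc zero) P
    ...   | inj₁ (a , a∈P , alone) = peel n P ∣P∣≤n ∣P∣≤5 (suc zero) a a∈P alone
    ...   | inj₂ partner₁ = covered-core P ∣P∣≤5 λ { zero → partner₀ ; (suc zero) → partner₁ }

-- Coverings on three and four colors

module _ (n : ℕ) where

  arcs : List (Arc (Fin n))
  arcs = filter (λ (a , b) → ¬? (a Fin.≟ b)) (cartesianProduct (allFin n) (allFin n))

  ∈-arcs : ∀ {a b} → a ≢ b → (a , b) ∈ arcs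
  ∈-arcs {a} {b} a≢b =
    ∈-filter⁺ (λ (a , b) → ¬? (a Fin.≟ b)) (∈-cartesianProduct⁺ (∈-allFin a) (∈-allFin b)) a≢b

  arcs-unique : Unique arcs
  arcs-unique = Unique.filter⁺ _ (Unique.cartesianProduct⁺ (Unique.allFin⁺ n) (Unique.allFin⁺ n))

Loopless : ∀ {C} → List (Arc C) → Set
Loopless P = ∀ {a b} → (a , b) ∈ P → a ≢ b

-- As a bipartite graph between tails and heads, the six loopless arcs on three colors form a
-- 6-cycle, so even all of them together can be covered.
covered-3 : (P : List (Arc (Fin 3))) → Loopless P → Covered P
covered-3 P loopless = search⇒covered (arcs 3) tt λ m → ∈-arcs 3 (loopless m)
  where open Covering (Fin._≟_ {3})

-- A check by evaluation: each selection of at most six of the twelve arcs is searched.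
search-arcs-4 : let open Covering (Fin._≟_ {4}) in
  All (λ k → All (λ S → T (search [] [] S)) (combinations k (arcs 4))) (upTo 7)
search-arcs-4 =
  toWitness {a? = All.all? (λ k → All.all? (λ S → T? (search [] [] S)) (combinations k (arcs 4))) (upTo 7)} tt
  where open Covering (Fin._≟_ {4})

covered-4 : (P : List (Arc (Fin 4))) → length P ≤ 6 → Loopless P → Covered P
covered-4 P ∣P∣≤6 loopless = search⇒covered S found
    λ m → ∈-filter⁺ (_∈? P) (∈-arcs 4 (loopless m)) m
  where
  open Covering (Fin._≟_ {4})
  open DecMembership _≟²_ using (_∈?_)
  -- `P` may list its arcs in any order and with repetitions; `S` is the same set in the order of
  -- `arcs 4`, hence one of the lists checked.
  S = filter (_∈? P) (arcs 4)
  ∣S∣≤6 : length S ≤ 6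
  ∣S∣≤6 = ℕ.≤-trans
    (unique-⊆⇒length≤ _≟²_ (Unique.filter⁺ (_∈? P) (arcs-unique 4))
      (λ m → proj₂ (∈-filter⁻ (_∈? P) {xs = arcs 4} m))) ∣P∣≤6
  found : T (search [] [] S)
  found = All.lookup (All.lookup search-arcs-4 (∈-upTo⁺ (s≤s ∣S∣≤6)))
                     (∈-combinations (filter-⊆ (_∈? P) (arcs 4)))

module _ {C : Set} (_≟_ : DecidableEquality C) where
  open DecMembership _≟_ using (_∈?_)

  label : ∀ {k} (U : List C) → .(length U ≤ suc k) → C → Fin (suc k)
  label U ∣U∣≤k x with x ∈? U
  ... | yes x∈U = Fin.inject≤ (Any.index x∈U) ∣U∣≤k
  -- A dummy value: only colors in `U` are ever relabelled with consequence.
  ... | no  _   = zero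

  label-injective : ∀ {k} U .(∣U∣≤k : length U ≤ suc k) {x y} → x ∈ U → y ∈ U →
                    label U ∣U∣≤k x ≡ label U ∣U∣≤k y → x ≡ y
  label-injective U ∣U∣≤k {x} {y} x∈U y∈U eq with x ∈? U | y ∈? U
  ... | no x∉U | _      = contradiction x∈U x∉U
  ... | yes _  | no y∉U = contradiction y∈U y∉U
  ... | yes p  | yes q  = trans (lookup-index p)
    (trans (cong (lookup U) (inject≤-injective _ _ _ _ eq)) (sym (lookup-index q)))

  covered-relabel : ∀ {k} (U : List C) → length U ≤ suc k → (P : List (Arc C)) →
                    (∀ {a b} → (a , b) ∈ P → a ∈ U × b ∈ U) → Loopless P →
                    (∀ (Q : List (Arc (Fin (suc k)))) → length Q ≡ length P → Loopless Q → Covered Q) →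
                    Covered P
  covered-relabel U ∣U∣≤k P P⊆U loopless cover = relabel (label U ∣U∣≤k)
    (λ m m′ → label-injective U ∣U∣≤k (proj₁ (P⊆U m)) (proj₁ (P⊆U m′))
            , label-injective U ∣U∣≤k (proj₂ (P⊆U m)) (proj₂ (P⊆U m′)))
    (cover _ (length-map _ P) loopless′)
    where
    loopless′ : Loopless (map _ P)
    loopless′ m a≡b with (a , b) , ab∈P , refl ← ∈-map⁻ _ m =
      loopless ab∈P (label-injective U ∣U∣≤k (proj₁ (P⊆U ab∈P)) (proj₂ (P⊆U ab∈P)) a≡b)

  -- Once five arcs or fewer and three colors or fewer are excluded, the sum leaves room only for
  -- six arcs on four colors.
  covered-≤10 : ∀ (U : List C) (P : List (Arc C)) →
                (∀ {a b} → (a , b) ∈ P → a ∈ U × b ∈ U) → Loopless P →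
                length P + length U ≤ 10 → Covered P
  covered-≤10 U P P⊆U loopless small with length P ℕ.≤? 5 | length U ℕ.≤? 3
  ... | yes ∣P∣≤5 | _         = Covering.covered-≤5 _≟_ P ∣P∣≤5
  ... | no  _     | yes ∣U∣≤3 = covered-relabel U ∣U∣≤3 P P⊆U loopless λ Q _ → covered-3 Q
  ... | no  ∣P∣≰5 | no  ∣U∣≰3 = covered-relabel U ∣U∣≤4 P P⊆U loopless
    λ Q eq → covered-4 Q (ℕ.≤-trans (ℕ.≤-reflexive eq) ∣P∣≤6)
    where
    ∣P∣≤6 : length P ≤ 6
    ∣P∣≤6 = ℕ.+-cancelʳ-≤ 4 (length P) 6 (ℕ.≤-trans (ℕ.+-monoʳ-≤ (length P) (ℕ.≰⇒> ∣U∣≰3)) small)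
    ∣U∣≤4 : length U ≤ 4
    ∣U∣≤4 = ℕ.+-cancelˡ-≤ 6 (length U) 4 (ℕ.≤-trans (ℕ.+-monoˡ-≤ (length U) (ℕ.≰⇒> ∣P∣≰5)) small)

-- The constant C₂

elements : ∀ {n} → Subset n → List (Fin n)
elements []            = []
elements (inside ∷ s)  = zero ∷ map suc (elements s)
elements (outside ∷ s) = map suc (elements s)

length-elements : ∀ {n} (s : Subset n) → length (elements s) ≡ card s
length-elements []            = refl
length-elements (inside ∷ s)  = cong suc (trans (length-map suc (elements s)) (length-elements s))
length-elements (outside ∷ s) = trans (length-map suc (elements s)) (length-elements s)

∈-elements : ∀ {n} {x : Fin n} {s : Subset n} → x ∈ˢ s → x ∈ elements s
∈-elements {s = inside ∷ s}  Vec.here        = here refl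
∈-elements {s = inside ∷ s}  (Vec.there x∈s) = there (∈-map⁺ suc (∈-elements x∈s))
∈-elements {s = outside ∷ s} (Vec.there x∈s) = ∈-map⁺ suc (∈-elements x∈s)

∈-⋃ : ∀ {n} {x : Fin n} {s} {ss : List (Subset n)} → s ∈ ss → x ∈ˢ s → x ∈ˢ ⋃ ss
∈-⋃ (here refl)  x∈s = x∈p∪q⁺ (inj₁ x∈s)
∈-⋃ (there s∈ss) x∈s = x∈p∪q⁺ (inj₂ (∈-⋃ s∈ss x∈s))

toArc : ∀ {m} → Tuple m 2 → Arc (Fin m)
toArc (a ∷ b ∷ []) = a , b

toArc-injective : ∀ {m} {x y : Tuple m 2} → toArc x ≡ toArc y → x ≡ y
toArc-injective {x = _ ∷ _ ∷ []} {_ ∷ _ ∷ []} refl = refl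

π⇒end : ∀ {m} i (x y : Tuple m 2) → π i x ≡ π i y → end i (toArc x) ≡ end i (toArc y)
π⇒end zero       (_ ∷ _ ∷ []) (_ ∷ _ ∷ []) = ∷-injectiveˡ
π⇒end (suc zero) (_ ∷ _ ∷ []) (_ ∷ _ ∷ []) = ∷-injectiveˡ

open Configuration using (tuples; size; supp; unique; proper)

covered⇒coverable : ∀ {m} (P : Configuration m 2) → Covered (map toArc (tuples P)) → Coverable P
covered⇒coverable P (part , sat) = part ∘ toArc , λ i x y (x∈P , px) (y∈P , py) eq →
  toArc-injective (sat i (∈-map⁺ toArc x∈P) (∈-map⁺ toArc y∈P) px py (π⇒end i x y eq))

coverable-≤10 : ∀ {m} (P : Configuration m 2) → size P + card (supp P) ≤ 10 → Coverable P
coverable-≤10 P small = covered⇒coverable P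
  (covered-≤10 Fin._≟_ (elements (supp P)) (map toArc (tuples P)) colors loopless
    (subst (_≤ 10) (sym (cong₂ _+_ (length-map toArc (tuples P)) (length-elements (supp P)))) small))
  where
  colors : ∀ {a b} → (a , b) ∈ map toArc (tuples P) → a ∈ elements (supp P) × b ∈ elements (supp P)
  colors m with (a ∷ b ∷ []) , x∈P , refl ← ∈-map⁻ toArc m =
      ∈-elements (∈-⋃ (∈-map⁺ _ x∈P) (∈-⋃ {s = ⁅ a ⁆} {⁅ a ⁆ ∷ ⁅ b ⁆ ∷ []} (here refl) (x∈⁅x⁆ a)))
    , ∈-elements (∈-⋃ (∈-map⁺ _ x∈P) (∈-⋃ {s = ⁅ b ⁆} {⁅ a ⁆ ∷ ⁅ b ⁆ ∷ []} (there (here refl)) (x∈⁅x⁆ b)))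
  loopless : Loopless (map toArc (tuples P))
  loopless m with (a ∷ b ∷ []) , x∈P , refl ← ∈-map⁻ toArc m
    with (a≢b VecAll.∷ VecAll.[]) VecAllPairs.∷ _ ← All.lookup (proper P) x∈P = a≢b

-- Tails 0 and 1, heads 2, 3 and 4. Six arcs and five colors attain 6 + 5 = 11.
K₂₃ : Configuration 5 2
K₂₃ = record
  { tuples = list
  ; unique = toWitness {a? = DecUnique.unique? (vec-≡-dec Fin._≟_) list} tt
  ; proper = toWitness {a? = All.all? (VecAllPairs.allPairs? λ a b → ¬? (a Fin.≟ b)) list} tt
  }
  where
  list : List (Tuple 5 2)
  list = (# 0 ∷ # 2 ∷ []) ∷ (# 0 ∷ # 3 ∷ []) ∷ (# 0 ∷ # 4 ∷ [])
       ∷ (# 1 ∷ # 2 ∷ []) ∷ (# 1 ∷ # 3 ∷ []) ∷ (# 1 ∷ # 4 ∷ []) ∷ []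

unique-lookup : ∀ {A : Set} {xs : List A} → Unique xs → ∀ {i j} → i Fin.< j → lookup xs i ≢ lookup xs j
unique-lookup (x∉xs ∷ _) {zero}  {suc j} _           = All.lookup x∉xs (∈-lookup j)
unique-lookup (_ ∷ uxs)  {suc i} {suc j} (s≤s i<j)   = unique-lookup uxs i<j

-- The six tuples would occupy distinct elements among the two tails and the
-- three heads.
¬coverable-K₂₃ : ¬ Coverable K₂₃
¬coverable-K₂₃ (part , sat) =
  let i , j , i<j , eq = pigeonhole ℕ.≤-refl (λ i → slot (part (tuple i)) (tuple i)) in
  unique-lookup (unique K₂₃) i<j (collide i j eq)
  where
  tuple : Fin 6 → Tuple 5 2
  tuple = lookup (tuples K₂₃)
  -- The end that an arc occupies exclusively in its part: the head in part 0, the tail in part 1.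
  -- No color is both a head and a tail, so slots of different parts never clash.
  slot : Fin 2 → Tuple 5 2 → Fin 5
  slot zero    (_ ∷ y ∷ []) = y
  slot (suc _) (x ∷ _ ∷ []) = x
  head≢tail : ∀ i j → slot zero (tuple i) ≢ slot (suc zero) (tuple j)
  head≢tail = toWitness {a? = all? λ i → all? λ j → ¬? (slot zero (tuple i) Fin.≟ slot (suc zero) (tuple j))} tt
  slot⇒π : ∀ i x y → slot i x ≡ slot i y → π i x ≡ π i y
  slot⇒π zero       (_ ∷ _ ∷ []) (_ ∷ _ ∷ []) = cong (_∷ [])
  slot⇒π (suc zero) (_ ∷ _ ∷ []) (_ ∷ _ ∷ []) = cong (_∷ [])
  collide : ∀ i j → slot (part (tuple i)) (tuple i) ≡ slot (part (tuple j)) (tuple j) → tuple i ≡ tuple j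
  collide i j eq with part (tuple i) in pi | part (tuple j) in pj
  ... | zero     | zero     = sat zero _ _ (∈-lookup i , pi) (∈-lookup j , pj) (slot⇒π zero (tuple i) (tuple j) eq)
  ... | suc zero | suc zero = sat (suc zero) _ _ (∈-lookup i , pi) (∈-lookup j , pj) (slot⇒π (suc zero) (tuple i) (tuple j) eq)
  ... | zero     | suc zero = contradiction eq (head≢tail i j)
  ... | suc zero | zero     = contradiction (sym eq) (head≢tail j i)

C₂≡11 : IsC 2 11
C₂≡11 = (5 , K₂₃ , ¬coverable-K₂₃ , refl) , λ c (m , P , ¬coverable , eq) →
  decidable-stable (11 ℕ.≤? c) λ c≱11 → ¬coverable
    (coverable-≤10 P (subst (_≤ 10) (sym eq) (ℕ.s≤s⁻¹ (ℕ.≰⇒> c≱11))))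

-- The upper bound from a non-coverable configuration

avoid : ∀ {A : Set} (_≟_ : DecidableEquality A) {m n} → m < n → (g : Fin m → A) {f : Fin n → A} →
        Injective _≡_ _≡_ f → ∃[ k ] ∀ i → g i ≢ f k
avoid _≟_ m<n g {f} f-inj with any? (λ k → all? λ i → ¬? (g i ≟ f k))
... | yes found = found
... | no  none  =
  -- If each `f k` were some `g i`, then, there being fewer indices i than k, one i would serve two
  -- different k, against the injectivity of `f`.
  let hit : ∀ k → ∃[ i ] ¬ ¬ (g i ≡ f k)
      hit k = ¬∀⟶∃¬ _ _ (λ i → ¬? (g i ≟ f k)) λ avoids → none (k , avoids)
      hit′ : ∀ k → g (proj₁ (hit k)) ≡ f k
      hit′ k = decidable-stable (g (proj₁ (hit k)) ≟ f k) (proj₂ (hit k))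
      i , j , i<j , eq = pigeonhole m<n (proj₁ ∘ hit)
  in contradiction (f-inj (trans (sym (hit′ i)) (trans (cong g eq) (hit′ j)))) (Fin.<⇒≢ i<j)

pattern page j = suc (suc j)

paint : ∀ {A : Set} {n} → A → A → (Fin n → A) → Fin (2 + n) → A
paint a b p zero       = a
paint a b p (suc zero) = b
paint a b p (page j)   = p j

paint-proper : ∀ {n q} {a b : Fin q} {p : Fin n → Fin q} → a ≢ b → (∀ j → a ≢ p j) → (∀ j → b ≢ p j) →
               Proper (book 2 n) (paint a b p)
paint-proper a≢b a≢p b≢p zero       zero       0≢0 = contradiction refl 0≢0
paint-proper a≢b a≢p b≢p zero       (suc zero) _ = a≢b
paint-proper a≢b a≢p b≢p zero       (page j)   _ = a≢p j
paint-proper a≢b a≢p b≢p (suc zero) zero       _ = ≢-sym a≢b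
paint-proper a≢b a≢p b≢p (suc zero) (suc zero) 1≢1 = contradiction refl 1≢1
paint-proper a≢b a≢p b≢p (suc zero) (page j)   _ = b≢p j
paint-proper a≢b a≢p b≢p (page j)   zero       _ = ≢-sym (a≢p j)
paint-proper a≢b a≢p b≢p (page j)   (suc zero) _ = ≢-sym (b≢p j)

-- The pages get colors outside Fin m that they do not guess on any tuple of P,
-- so the spines alone would have to cover P.
¬coverable⇒¬winning : ∀ {m} (P : Configuration m 2) → ¬ Coverable P → ∀ {n q} → m + suc (size P) ≤ q →
                      (s : Strategy (book 2 n) q) → ¬ Winning (book 2 n) s
¬coverable⇒¬winning {m} P ¬coverable {n} {q} m+1+∣P∣≤q s wins = ¬coverable (part , sat)
  where
  open Strategy s
  -- A page makes at most one guess per tuple of `P`, so one color more than there are tuples leaves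
  -- a color that it never guesses.
  k = suc (size P)
  embed : Fin (m + k) → Fin q
  embed a = Fin.inject≤ a m+1+∣P∣≤q
  embed-injective : Injective _≡_ _≡_ embed
  embed-injective = inject≤-injective m+1+∣P∣≤q m+1+∣P∣≤q _ _
  spine : Fin m → Fin q
  spine a = embed (a Fin.↑ˡ k)
  candidate : Fin k → Fin q
  candidate c = embed (m Fin.↑ʳ c)
  spine≢candidate : ∀ a c → spine a ≢ candidate c
  spine≢candidate a c eq
    with () ← trans (sym (Fin.splitAt-↑ˡ m a k))
                (trans (cong (Fin.splitAt m) (embed-injective eq)) (Fin.splitAt-↑ʳ m k c))
  spine-injective : Injective _≡_ _≡_ spine
  spine-injective eq = Fin.↑ˡ-injective k _ _ (embed-injective eq)
  candidate-injective : Injective _≡_ _≡_ candidate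
  candidate-injective eq = Fin.↑ʳ-injective m _ _ (embed-injective eq)

  coloring : (Fin n → Fin q) → Tuple m 2 → Coloring (book 2 n) q
  coloring p (a ∷ b ∷ []) = paint (spine a) (spine b) p

  -- A page does not see the other pages, so its guesses can be read off with a placeholder on all
  -- pages, before the actual page colors are chosen.
  blank : Fin n → Fin q
  blank _ = candidate zero

  choice : ∀ j → ∃[ c ] ∀ i → guess (page j) (coloring blank (lookup (tuples P) i)) ≢ candidate c
  choice j = avoid Fin._≟_ ℕ.≤-refl _ candidate-injective

  pages : Fin n → Fin q
  pages j = candidate (proj₁ (choice j))

  page-wrong : ∀ j x → x ∈ tuples P → guess (page j) (coloring pages x) ≢ pages j
  page-wrong j x x∈P eq = proj₂ (choice j) (Any.index x∈P)
    (trans (cong (λ x → guess (page j) (coloring blank x)) (sym (lookup-index x∈P)))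
           (trans (local (page j) _ _ (same x)) eq))
    where
    same : ∀ x u → Graph._~_ (book 2 n) u (page j) → coloring blank x u ≡ coloring pages x u
    same (_ ∷ _ ∷ []) zero       _ = refl
    same (_ ∷ _ ∷ []) (suc zero) _ = refl

  Right : Fin (2 + n) → Tuple m 2 → Set
  Right v x = guess v (coloring pages x) ≡ coloring pages x v

  coloring-proper : ∀ x → x ∈ tuples P → Proper (book 2 n) (coloring pages x)
  coloring-proper (a ∷ b ∷ []) x∈P with (a≢b VecAll.∷ VecAll.[]) VecAllPairs.∷ _ ← All.lookup (proper P) x∈P =
    paint-proper (λ eq → a≢b (spine-injective eq)) (λ j → spine≢candidate a _) (λ j → spine≢candidate b _)

  right : ∀ x → x ∈ tuples P → Right zero x ⊎ Right (suc zero) x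
  right x@(_ ∷ _ ∷ []) x∈P = spine-right (wins _ (coloring-proper x x∈P))
    where
    spine-right : ∃[ v ] Right v x → Right zero x ⊎ Right (suc zero) x
    spine-right (zero     , r) = inj₁ r
    spine-right (suc zero , r) = inj₂ r
    spine-right (page j   , r) = contradiction r (page-wrong j x x∈P)

  right? : ∀ x → Dec (Right zero x)
  right? x = guess zero (coloring pages x) Fin.≟ coloring pages x zero

  part : Tuple m 2 → Fin 2
  part x with right? x
  ... | yes _ = zero
  ... | no  _ = suc zero

  part≡0 : ∀ x → part x ≡ zero → Right zero x
  part≡0 x _ with right? x
  ... | yes r = r

  part≡1 : ∀ x → x ∈ tuples P → part x ≡ suc zero → Right (suc zero) x
  part≡1 x x∈P _ with right? x
  ... | no wrong = [ (λ r → contradiction r wrong) , id ] (right x x∈P)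

  -- Tuples that agree after deleting coordinate i look the same to spine i, the page colors being
  -- fixed. It makes the same guess on both and is right on both, so the deleted colors agree too.
  sat : ∀ i → Saturated i (λ x → x ∈ tuples P × part x ≡ i)
  sat zero x@(_ ∷ _ ∷ []) y@(_ ∷ _ ∷ []) (_ , px) (_ , py) refl = cong (_∷ _)
    (spine-injective (trans (sym (part≡0 x px)) (trans (local zero _ _ same) (part≡0 y py))))
    where
    same : ∀ u → Graph._~_ (book 2 n) u zero → coloring pages x u ≡ coloring pages y u
    same zero       0≢0 = contradiction refl 0≢0
    same (suc zero) _   = refl
    same (page j)   _   = refl
  sat (suc zero) x@(_ ∷ _ ∷ []) y@(_ ∷ _ ∷ []) (x∈P , px) (y∈P , py) refl = cong (λ b → _ ∷ b ∷ [])
    (spine-injective (trans (sym (part≡1 x x∈P px)) (trans (local (suc zero) _ _ same) (part≡1 y y∈P py))))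
    where
    same : ∀ u → Graph._~_ (book 2 n) u (suc zero) → coloring pages x u ≡ coloring pages y u
    same zero       _   = refl
    same (suc zero) 1≢1 = contradiction refl 1≢1
    same (page j)   _   = refl

-- A winning strategy with 11 colors

module _ {r : ℕ} {P : Fin (suc r) → Set} (P? : ∀ a → Dec (P a)) where

  pick : Fin (suc r)
  pick with any? P?
  ... | yes (a , _) = a
  ... | no  _       = zero

  pick-unique : ∀ {a} → P a → (∀ {b} → P b → b ≡ a) → pick ≡ a
  pick-unique {a} Pa unique with any? P?
  ... | yes (b , Pb) = unique Pb
  ... | no  none     = contradiction (a , Pa) none

-- Both spines see the page colors `v`. They know that, if all pages are wrong, their own pair is
-- among `survivors v`, and they follow a covering of that list agreed on beforehand.
module SpineStrategy {n r : ℕ} (F : Fin n → Arc (Fin (suc r)) → Fin (suc r))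
  (survivors : Vec (Fin (suc r)) n → List (Arc (Fin (suc r))))
  (survive : ∀ v {a b} → a ≢ b → (∀ j → a ≢ Vec.lookup v j) → (∀ j → b ≢ Vec.lookup v j) →
             (∀ j → F j (a , b) ≢ Vec.lookup v j) → (a , b) ∈ survivors v)
  (cover : ∀ v → Covered (survivors v))
  where

  private
    q = suc r
    open DecMembership (Covering._≟²_ (Fin._≟_ {q})) using (_∈?_)

    -- Inverse to the deletion of coordinate i: spine i sees `b` and has to guess `a`.
    join-end : Fin 2 → Fin q → Fin q → Arc (Fin q)
    join-end zero       a b = a , b
    join-end (suc zero) a b = b , a

    end-join : ∀ i a b → end i (join-end i a b) ≡ b
    end-join zero       a b = refl
    end-join (suc zero) a b = refl

    join-injective : ∀ i {a c b} → join-end i a b ≡ join-end i c b → a ≡ c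
    join-injective zero       refl = refl
    join-injective (suc zero) refl = refl

    part : Vec (Fin q) n → Arc (Fin q) → Fin 2
    part v = proj₁ (cover v)

    Candidate : Fin 2 → Vec (Fin q) n → Fin q → Fin q → Set
    Candidate i v b a = join-end i a b ∈ survivors v × part v (join-end i a b) ≡ i

    candidate? : ∀ i v b a → Dec (Candidate i v b a)
    candidate? i v b a = (join-end i a b ∈? survivors v) ×-dec (part v (join-end i a b) Fin.≟ i)

    spine : Fin 2 → Vec (Fin q) n → Fin q → Fin q
    spine i v b = pick (candidate? i v b)

    -- Part i is saturated, so the color seen leaves a single candidate, and `pick` has to return
    -- it.
    spine-right : ∀ i v a b → Candidate i v b a → spine i v b ≡ a
    spine-right i v a b cand@(∈v , p) = pick-unique (candidate? i v b) cand λ {c} (∈v′ , p′) →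
      join-injective i (proj₂ (cover v) i ∈v′ ∈v p′ p (trans (end-join i c b) (sym (end-join i a b))))

    pages : (Fin (2 + n) → Fin q) → Vec (Fin q) n
    pages c = tabulate λ j → c (page j)

    guess : Fin (2 + n) → (Fin (2 + n) → Fin q) → Fin q
    guess zero       c = spine zero (pages c) (c (suc zero))
    guess (suc zero) c = spine (suc zero) (pages c) (c zero)
    guess (page j)   c = F j (c zero , c (suc zero))

    local : ∀ v c d → (∀ u → Graph._~_ (book 2 n) u v → c u ≡ d u) → guess v c ≡ guess v d
    local zero       c d eq = cong₂ (spine zero) (tabulate-cong λ j → eq (page j) _) (eq (suc zero) λ ())
    local (suc zero) c d eq = cong₂ (spine (suc zero)) (tabulate-cong λ j → eq (page j) _) (eq zero λ ())
    local (page j)   c d eq = cong₂ (λ a b → F j (a , b)) (eq zero _) (eq (suc zero) _)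

  strategy : Strategy (book 2 n) (suc r)
  strategy = record { guess = guess ; local = local }

  winning : Winning (book 2 n) strategy
  winning c c-proper with any? (λ j → guess (page j) c Fin.≟ c (page j))
  ... | yes (j , right) = page j , right
  ... | no  wrong       = spine-wins (part v u) refl
    where
    v = pages c
    u = c zero , c (suc zero)
    differ : ∀ {a} j → a ≢ c (page j) → a ≢ Vec.lookup v j
    differ j a≢c eq = a≢c (trans eq (lookup∘tabulate (λ j → c (page j)) j))
    u∈ : u ∈ survivors v
    u∈ = survive v (c-proper zero (suc zero) λ ())
      (λ j → differ j (c-proper zero (page j) _))
      (λ j → differ j (c-proper (suc zero) (page j) _))
      (λ j → differ j (λ right → wrong (j , right)))
    spine-wins : ∀ i → part v u ≡ i → ∃[ w ] guess w c ≡ c w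
    spine-wins zero       p = zero , spine-right zero v _ _ (u∈ , p)
    spine-wins (suc zero) p = suc zero , spine-right (suc zero) v _ _ (u∈ , p)

length-concatMap : ∀ {A B : Set} (f : A → List B) xs → length (concatMap f xs) ≡ sum (map (length ∘ f) xs)
length-concatMap f []       = refl
length-concatMap f (x ∷ xs) = trans (length-++ (f x)) (cong (λ m → length (f x) + m) (length-concatMap f xs))

sum-cong : ∀ {A : Set} {f g : A → ℕ} xs → (∀ x → f x ≡ g x) → sum (map f xs) ≡ sum (map g xs)
sum-cong []       eq = refl
sum-cong (x ∷ xs) eq = cong₂ _+_ (eq x) (sum-cong xs eq)

length-cartesianProduct : ∀ {A B : Set} (xs : List A) (ys : List B) →
                          length (cartesianProduct xs ys) ≡ length xs * length ys
length-cartesianProduct []       ys = refl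
length-cartesianProduct (x ∷ xs) ys = trans (length-++ (map (x ,_) ys))
  (cong₂ _+_ (length-map (x ,_) ys) (length-cartesianProduct xs ys))

module _ {r : ℕ} where
  private
    q = suc r
    _≟²_ = Covering._≟²_ (Fin._≟_ {q})
  open DecMembership (Fin._≟_ {q}) using (_∈?_)

  outside? : ∀ D a → Dec (a ∉ D)
  outside? D a = ¬? (a ∈? D)

  complement : List (Fin q) → List (Fin q)
  complement D = filter (outside? D) (allFin q)

  ∈-complement : ∀ {D a} → a ∉ D → a ∈ complement D
  ∈-complement {D} {a} a∉D = ∈-filter⁺ (outside? D) (∈-allFin a) a∉D

  ∉-complement : ∀ {D a} → a ∈ complement D → a ∉ D
  ∉-complement {D} a∈ = proj₂ (∈-filter⁻ (outside? D) {xs = allFin q} a∈)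

  complement-unique : ∀ D → Unique (complement D)
  complement-unique D = Unique.filter⁺ (outside? D) (Unique.allFin⁺ q)

  length-complement : ∀ {D} → Unique D → length D + length (complement D) ≤ q
  length-complement {D} uD = ℕ.≤-trans (ℕ.≤-reflexive (sym (length-++ D)))
    (ℕ.≤-trans (unique-⊆⇒length≤ Fin._≟_
        (Unique.++⁺ uD (complement-unique D) λ (a∈D , a∈′) → ∉-complement {D} a∈′ a∈D)
        (λ {a} _ → ∈-allFin a))
      (ℕ.≤-reflexive (length-tabulate id)))

  square : List (Fin q) → List (Arc (Fin q))
  square U = cartesianProduct U U

  -- A task (S , D) is to guess each color of D on some arc of S.
  Task : Set
  Task = List (Arc (Fin q)) × List (Fin q)

  tasks : List ℕ → List Task
  tasks = concatMap λ d →
    concatMap (λ D → map (_, D) (combinations d (square (complement D)))) (combinations d (allFin q))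

  -- Only the sets D are enumerated; the choices of S enter through a binomial coefficient, so the
  -- total evaluates without the tasks being listed.
  taskTotal : List ℕ → ℕ
  taskTotal ds = sum (map (λ d → sum (map (λ D → (length (complement D) * length (complement D)) C d)
                                          (combinations d (allFin q)))) ds)

  length-tasks : ∀ ds → length (tasks ds) ≡ taskTotal ds
  length-tasks ds = trans (length-concatMap _ ds) (sum-cong ds λ d →
    trans (length-concatMap _ (combinations d (allFin q))) (sum-cong (combinations d (allFin q)) λ D →
      trans (length-map (_, D) (combinations d (square (complement D))))
        (trans (length-combinations d (square (complement D)))
          (cong (_C d) (length-cartesianProduct (complement D) (complement D))))))

  ∈-tasks : ∀ {ds d S D} → d ∈ ds → d ≡ length S → d ≡ length D →
            S ⊑ square (complement D) → D ⊑ allFin q → (S , D) ∈ tasks ds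
  ∈-tasks {S = S} {D} d∈ds refl ∣S∣≡∣D∣ S⊑ D⊑ = ∈-concatMap⁺ _ (lose d∈ds
    (∈-concatMap⁺ _ (lose (subst (λ d → D ∈ combinations d (allFin q)) (sym ∣S∣≡∣D∣) (∈-combinations D⊑))
      (∈-map⁺ (_, D) (∈-combinations S⊑)))))

  -- Arcs and colors are matched by position, a bijection from S to D when both have the same length
  -- and no repetitions. The final `zero` is the arbitrary guess off S.
  perform : List (Arc (Fin q)) → List (Fin q) → Arc (Fin q) → Fin q
  perform (s ∷ S) (c ∷ D) a with a ≟² s
  ... | yes _ = c
  ... | no  _ = perform S D a
  perform _       _       _ = zero

  perform-hits : ∀ {S D c} → Unique S → length S ≡ length D → c ∈ D → ∃[ s ] s ∈ S × perform S D s ≡ c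
  perform-hits {s ∷ S} {c ∷ D} _ _ (here refl) = s , here refl , at-s
    where
    at-s : perform (s ∷ S) (c ∷ D) s ≡ c
    at-s with s ≟² s
    ... | yes _   = refl
    ... | no  s≢s = contradiction refl s≢s
  perform-hits {s ∷ S} {c ∷ D} {c′} (s∉S ∷ uS) eq (there c′∈D)
    with t , t∈S , hit ← perform-hits uS (ℕ.suc-injective eq) c′∈D = t , there t∈S , at-t
    where
    at-t : perform (s ∷ S) (c ∷ D) t ≡ c′
    at-t with t ≟² s
    ... | yes refl = contradiction refl (All.lookup s∉S t∈S)
    ... | no  _    = hit

module _ {q : ℕ} where
  shown? : ∀ {n} (v : Vec (Fin q) n) a → Dec (∃[ j ] a ≡ Vec.lookup v j)
  shown? v a = any? λ j → a Fin.≟ Vec.lookup v j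

  image : ∀ {n} → Vec (Fin q) n → List (Fin q)
  image v = filter (shown? v) (allFin q)

  image-unique : ∀ {n} (v : Vec (Fin q) n) → Unique (image v)
  image-unique v = Unique.filter⁺ (shown? v) (Unique.allFin⁺ q)

  ∈-image : ∀ {n} (v : Vec (Fin q) n) j → Vec.lookup v j ∈ image v
  ∈-image v j = ∈-filter⁺ (shown? v) (∈-allFin (Vec.lookup v j)) (j , refl)

  image-∈ : ∀ {n} (v : Vec (Fin q) n) {a} → a ∈ image v → ∃[ j ] a ≡ Vec.lookup v j
  image-∈ v a∈ = proj₂ (∈-filter⁻ (shown? v) {xs = allFin q} a∈)

module PageStrategy {n r : ℕ} (q≤11 : suc r ≤ 11) (n≥1 : 1 ≤ n) (ts : List (Task {r})) (∣ts∣≤n : length ts ≤ n)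
  (assigned : ∀ {d S D} → 1 ≤ d → d ≤ 7 → d ≡ length S → d ≡ length D →
              S ⊑ square (complement D) → D ⊑ allFin (suc r) → (S , D) ∈ ts)
  where
  private
    q = suc r

  F : Fin n → Arc (Fin q) → Fin q
  F j with Fin.toℕ j ℕ.<? length ts
  ... | yes j< = let S , D = lookup ts (Fin.fromℕ< j<) in perform S D
  -- Pages beyond the number of tasks guess a fixed color.
  ... | no  _  = λ _ → zero

  page-of : ∀ {t} → t ∈ ts → ∃[ j ] ∀ a → F j a ≡ perform (proj₁ t) (proj₂ t) a
  page-of {t} t∈ts = j , F-j
    where
    i = Any.index t∈ts
    j = Fin.inject≤ i ∣ts∣≤n
    F-j : ∀ a → F j a ≡ perform (proj₁ t) (proj₂ t) a
    F-j a with Fin.toℕ j ℕ.<? length ts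
    ... | yes j< = cong (λ t → perform (proj₁ t) (proj₂ t) a)
      (trans (cong (lookup ts) (Fin.toℕ-injective (trans (Fin.toℕ-fromℕ< j<) (Fin.toℕ-inject≤ i ∣ts∣≤n))))
             (sym (lookup-index t∈ts)))
    ... | no  j≮ = contradiction (subst (_< length ts) (sym (Fin.toℕ-inject≤ i ∣ts∣≤n)) (Fin.toℕ<n i)) j≮

  module _ (v : Vec (Fin q) n) where
    private
      D = image v
      U = complement D

    Alive : Arc (Fin q) → Set
    Alive u = proj₁ u ≢ proj₂ u × (∀ j → F j u ≢ Vec.lookup v j)

    alive? : ∀ u → Dec (Alive u)
    alive? u = ¬? (proj₁ u Fin.≟ proj₂ u) ×-dec all? λ j → ¬? (F j u Fin.≟ Vec.lookup v j)

    survivors : List (Arc (Fin q))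
    survivors = filter alive? (square U)

    survive : ∀ {a b} → a ≢ b → (∀ j → a ≢ Vec.lookup v j) → (∀ j → b ≢ Vec.lookup v j) →
              (∀ j → F j (a , b) ≢ Vec.lookup v j) → (a , b) ∈ survivors
    survive a≢b a∉v b∉v wrong =
      ∈-filter⁺ alive? (∈-cartesianProduct⁺ (∈-complement (∉D a∉v)) (∈-complement (∉D b∉v))) (a≢b , wrong)
      where
      ∉D : ∀ {a} → (∀ j → a ≢ Vec.lookup v j) → a ∉ D
      ∉D a∉v a∈D with j , eq ← image-∈ v a∈D = a∉v j eq

    private
      alive : ∀ {u} → u ∈ survivors → Alive u
      alive u∈ = proj₂ (∈-filter⁻ alive? {xs = square U} u∈)

      colors : ∀ {a b} → (a , b) ∈ survivors → a ∈ U × b ∈ U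
      colors u∈ = ∈-cartesianProduct⁻ U U (proj₁ (∈-filter⁻ alive? {xs = square U} u∈))

      survivors-unique : Unique survivors
      survivors-unique =
        Unique.filter⁺ alive? (Unique.cartesianProduct⁺ (complement-unique D) (complement-unique D))

      1≤∣D∣ : 1 ≤ length D
      1≤∣D∣ with D | ∈-image v (Fin.fromℕ< n≥1)
      ... | _ ∷ _ | _ = s≤s z≤n

      -- Otherwise the first |D| survivors form a set S for which the task (S , D) is assigned to
      -- some page j. The color shown by j lies in D, so j guesses it at some s in S; there j would
      -- be right, yet s survives.
      few-survivors : length D ≤ 7 → length survivors < length D
      few-survivors ∣D∣≤7 = ℕ.≰⇒> impossible
        where
        S = take (length D) survivors
        length-S : length D ≤ length survivors → length D ≡ length S
        length-S enough = sym (trans (length-take (length D) survivors) (ℕ.m≤n⇒m⊓n≡m enough))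
        impossible : ¬ length D ≤ length survivors
        impossible enough
          with j , F-j ← page-of (assigned 1≤∣D∣ ∣D∣≤7 (length-S enough) refl
                 (⊑-trans (take-⊆ (length D) survivors) (filter-⊆ alive? (square U))) (filter-⊆ (shown? v) (allFin q)))
          with s , s∈S , hit ← perform-hits (Unique.take⁺ (length D) survivors-unique) (sym (length-S enough)) (∈-image v j)
          = proj₂ (alive (⊑-lookup (take-⊆ (length D) survivors) s∈S)) j (trans (F-j s) hit)

    -- For |D| at most 7, the survivors number at most |D| - 1, and |D| + |U| is at most 11, which
    -- gives the 10 of `covered-≤10`. For |D| at least 8, three colors remain.
    cover : Covered survivors
    cover with length D ℕ.≤? 7
    ... | yes ∣D∣≤7 = covered-≤10 Fin._≟_ U survivors colors (proj₁ ∘ alive)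
      (ℕ.s≤s⁻¹ (ℕ.≤-trans (ℕ.+-monoˡ-≤ (length U) (few-survivors ∣D∣≤7)) (ℕ.≤-trans (length-complement (image-unique v)) q≤11)))
    ... | no  ∣D∣≰7 = covered-relabel Fin._≟_ U ∣U∣≤3 survivors colors (proj₁ ∘ alive) λ Q _ → covered-3 Q
      where
      ∣U∣≤3 : length U ≤ 3
      ∣U∣≤3 = ℕ.+-cancelˡ-≤ 8 (length U) 3
        (ℕ.≤-trans (ℕ.+-monoˡ-≤ (length U) (ℕ.≰⇒> ∣D∣≰7)) (ℕ.≤-trans (length-complement (image-unique v)) q≤11))

  open SpineStrategy F survivors survive cover public

sizes : List ℕ
sizes = applyUpTo suc 7

taskTotal-value : taskTotal {10} sizes ≡ 336738644
taskTotal-value = refl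

-- The explicit assignment of tasks needs fewer pages than the bound of the theorem, so that many
-- pages suffice.
task-count : length (tasks {10} sizes) ≤ 364683163
task-count = ℕ.≤-trans (ℕ.≤-reflexive (trans (length-tasks {10} sizes) taskTotal-value)) (ℕ.≤ᵇ⇒≤ 336738644 364683163 tt)

winning-11 : ∀ {n} → 364683163 ≤ n → Σ[ s ∈ Strategy (book 2 n) 11 ] Winning (book 2 n) s
winning-11 {n} large = Pages.strategy , Pages.winning
  where
  ∈-sizes : ∀ {d} → 1 ≤ d → d ≤ 7 → d ∈ sizes
  ∈-sizes {suc d} _ d≤7 = ∈-applyUpTo⁺ suc d≤7
  assigned : ∀ {d S D} → 1 ≤ d → d ≤ 7 → d ≡ length S → d ≡ length D →
             S ⊑ square (complement D) → D ⊑ allFin 11 → (S , D) ∈ tasks {10} sizes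
  assigned d≥1 d≤7 = ∈-tasks {ds = sizes} (∈-sizes d≥1 d≤7)
  n≥1 : 1 ≤ n
  n≥1 = ℕ.≤-trans (ℕ.≤ᵇ⇒≤ 1 364683163 tt) large
  module Pages = PageStrategy ℕ.≤-refl n≥1 (tasks {10} sizes) (ℕ.≤-trans task-count large) assigned

-- Existence of the hat-guessing number

module _ (G : Graph) (q : ℕ) where
  open Graph G

  private
    color : Fin (q ℕ.^ order) → Coloring G q
    color = finToFun

    Table : Set
    Table = Vertex → Fin (q ℕ.^ order) → Fin q

    Local : Table → Set
    Local g = ∀ v i j → (∀ u → u ~ v → color i u ≡ color j u) → g v i ≡ g v j

    Wins : Table → Set
    Wins g = ∀ i → Proper G (color i) → ∃[ v ] g v i ≡ color i v

    local? : ∀ g → Dec (Local g)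
    local? g = all? λ v → all? λ i → all? λ j →
      (all? λ u → (u ~? v) →-dec (color i u Fin.≟ color j u)) →-dec (g v i Fin.≟ g v j)

    wins? : ∀ g → Dec (Wins g)
    wins? g = all? λ i →
      (all? λ u → all? λ v → (u ~? v) →-dec ¬? (color i u Fin.≟ color i v)) →-dec
      any? λ v → g v i Fin.≟ color i v

    table : Fin ((q ℕ.^ (q ℕ.^ order)) ℕ.^ order) → Table
    table k v = finToFun (finToFun k v)

    code : Table → Fin ((q ℕ.^ (q ℕ.^ order)) ℕ.^ order)
    code g = funToFin (λ v → funToFin (g v))

    table-code : ∀ g v i → table (code g) v i ≡ g v i
    table-code g v i = trans (cong (λ f → finToFun f i) (finToFun-funToFin (funToFin ∘ g) v))
                             (finToFun-funToFin (g v) i)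

    decode : ∃[ k ] Local (table k) × Wins (table k) → Σ[ s ∈ Strategy G q ] Winning G s
    decode (k , local , wins) = s , s-wins
      where
      s : Strategy G q
      s = record
        { guess = λ v c → table k v (funToFin c)
        ; local = λ v c d eq → local v _ _ λ u u~v →
            trans (finToFun-funToFin c u) (trans (eq u u~v) (sym (finToFun-funToFin d u)))
        }
      s-wins : Winning G s
      s-wins c c-proper = let v , right = wins (funToFin c) λ u v u~v eq → c-proper u v u~v
                                (trans (sym (finToFun-funToFin c u)) (trans eq (finToFun-funToFin c v)))
                          in v , trans right (finToFun-funToFin c v)

    encode : Σ[ s ∈ Strategy G q ] Winning G s → ∃[ k ] Local (table k) × Wins (table k)
    encode (s , wins) = code g
      , (λ v i j eq → trans (table-code g v i) (trans (local v _ _ eq) (sym (table-code g v j))))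
      , λ i i-proper → let v , right = wins (color i) i-proper in v , trans (table-code g v i) right
      where
      open Strategy s
      g : Table
      g v i = guess v (color i)

  -- Strategies are functions of functions, so the search runs over tables indexed by the finitely
  -- many codes of colorings. A decoded table is read at `funToFin c`, whose coloring agrees with
  -- `c` at every vertex.
  winning? : Dec (Σ[ s ∈ Strategy G q ] Winning G s)
  winning? = map′ decode encode (any? λ k → local? (table k) ×-dec wins? (table k))

-- Vacuous, since a vertex cannot be given any of zero colors. It guarantees that the search for a
-- maximum ends.
winning-0 : ∀ G → Graph.Vertex G → Σ[ s ∈ Strategy G 0 ] Winning G s
winning-0 G v = record { guess = λ u c → c u ; local = λ u c → absurd (c u) } , λ c → absurd (c v)
  where
  absurd : {A : Set} → Fin 0 → A
  absurd ()

maximum : ∀ {P : ℕ → Set} → (∀ n → Dec (P n)) → P 0 → ∀ b → (∀ n → P n → n ≤ b) → ∃[ m ] IsMaximum P m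
maximum P? P0 zero    bound = 0 , P0 , bound
maximum P? P0 (suc b) bound with P? (suc b)
... | yes Pb = suc b , Pb , bound
... | no ¬Pb = maximum P? P0 b λ n Pn → ℕ.s≤s⁻¹ (ℕ.≤∧≢⇒< (bound n Pn) λ { refl → ¬Pb Pn })

hgp-exists : ∀ G → Graph.Vertex G → ∀ b → (∀ q → Σ[ s ∈ Strategy G q ] Winning G s → q ≤ b) → ∃[ h ] IsHGP G h
hgp-exists G v = maximum (winning? G) (winning-0 G v)

-- The numerical bound

1/_! : ℕ → ℚ
1/ n ! = (+ 1 ℚ./ (n !)) {{n !≢0}}

term : ℚ → ℕ → ℚ
term q n = (q ^ℚ n) ℚ.* 1/ n !

2/a≤1/b : ∀ a b .{{_ : ℕ.NonZero a}} .{{_ : ℕ.NonZero b}} → b ℕ.+ b ℕ.≤ a →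
          (+ 1 ℚ./ a) ℚ.+ (+ 1 ℚ./ a) ℚ.≤ (+ 1 ℚ./ b)
2/a≤1/b a@(suc a-1) b@(suc b-1) b+b≤a = ℚ.toℚᵘ-cancel-≤ (begin
  ℚ.toℚᵘ ((+ 1 ℚ./ a) ℚ.+ (+ 1 ℚ./ a))          ≃⟨ ℚ.toℚᵘ-homo-+ (+ 1 ℚ./ a) (+ 1 ℚ./ a) ⟩
  ℚ.toℚᵘ (+ 1 ℚ./ a) ℚᵘ.+ ℚ.toℚᵘ (+ 1 ℚ./ a)    ≃⟨ ℚᵘ.+-cong (ℚ.toℚᵘ-fromℚᵘ 1/a) (ℚ.toℚᵘ-fromℚᵘ 1/a) ⟩
  1/a ℚᵘ.+ 1/a                                  ≤⟨ ℚᵘ.*≤* cross ⟩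
  mkℚᵘ (+ 1) b-1                                ≃⟨ ℚ.toℚᵘ-fromℚᵘ (mkℚᵘ (+ 1) b-1) ⟨
  ℚ.toℚᵘ (+ 1 ℚ./ b)                            ∎)
  where
  open ℚᵘ.≤-Reasoning
  1/a = mkℚᵘ (+ 1) a-1
  bound : (a ℕ.+ a) ℕ.* b ℕ.≤ a ℕ.* a
  bound = ℕ.≤-trans (ℕ.≤-reflexive (trans (ℕ.*-distribʳ-+ b a a) (sym (ℕ.*-distribˡ-+ a b b)))) (ℕ.*-monoʳ-≤ a b+b≤a)
  cross : (+ 1 ℤ.* + a ℤ.+ + 1 ℤ.* + a) ℤ.* + b ℤ.≤ + 1 ℤ.* (+ a ℤ.* + a)
  cross = subst₂ ℤ._≤_
    (trans (ℤ.pos-* (a ℕ.+ a) b) (cong (λ x → (x ℤ.+ x) ℤ.* + b) (sym (ℤ.*-identityˡ (+ a)))))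
    (trans (ℤ.pos-* a a) (sym (ℤ.*-identityˡ (+ a ℤ.* + a))))
    (ℤ.+≤+ bound)

p≤p+q : ∀ p q .{{_ : NonNegative q}} → p ℚ.≤ p ℚ.+ q
p≤p+q p q = ℚ.≤-trans (ℚ.≤-reflexive (sym (ℚ.+-identityʳ p))) (ℚ.+-monoʳ-≤ p (ℚ.nonNegative⁻¹ q))

1/!-nonNeg : ∀ n → NonNegative (1/ n !)
1/!-nonNeg n = ℚ.normalize-nonNeg 1 (n !) {{n !≢0}}

^-nonNeg : ∀ q .{{_ : NonNegative q}} n → NonNegative (q ^ℚ n)
^-nonNeg q zero    = _
^-nonNeg q (suc n) = ℚ.nonNeg*nonNeg⇒nonNeg q (q ^ℚ n) {{^-nonNeg q n}}

term-nonNeg : ∀ q .{{_ : NonNegative q}} n → NonNegative (term q n)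
term-nonNeg q n = ℚ.nonNeg*nonNeg⇒nonNeg (q ^ℚ n) {{^-nonNeg q n}} (1/ n !) {{1/!-nonNeg n}}

^-mono-≤ : ∀ {p q} .{{_ : NonNegative p}} .{{_ : NonNegative q}} → p ℚ.≤ q → ∀ n → p ^ℚ n ℚ.≤ q ^ℚ n
^-mono-≤         p≤q zero    = ℚ.≤-refl
^-mono-≤ {p} {q} p≤q (suc n) = ℚ.≤-trans (ℚ.*-monoˡ-≤-nonNeg p (^-mono-≤ p≤q n))
                                         (ℚ.*-monoʳ-≤-nonNeg (q ^ℚ n) {{^-nonNeg q n}} p≤q)

expSum-monoˡ : ∀ {p q} .{{_ : NonNegative p}} .{{_ : NonNegative q}} → p ℚ.≤ q → ∀ n → expSum p n ℚ.≤ expSum q n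
expSum-monoˡ p≤q zero    = ℚ.≤-refl
expSum-monoˡ p≤q (suc n) = ℚ.+-mono-≤ (expSum-monoˡ p≤q n)
  (ℚ.*-monoʳ-≤-nonNeg (1/ n !) {{1/!-nonNeg n}} (^-mono-≤ p≤q n))

expSum-monoʳ : ∀ q .{{_ : NonNegative q}} n k → expSum q n ℚ.≤ expSum q (k ℕ.+ n)
expSum-monoʳ q n zero    = ℚ.≤-refl
expSum-monoʳ q n (suc k) = ℚ.≤-trans (expSum-monoʳ q n k)
  (p≤p+q (expSum q (k ℕ.+ n)) (term q (k ℕ.+ n)) {{term-nonNeg q (k ℕ.+ n)}})

-- For q at most 1 the powers do not grow, while for n at least 1 the factorial at least doubles
-- from n to n + 1.
term-halves : ∀ q .{{_ : NonNegative q}} → q ℚ.≤ 1ℚ → ∀ n → 1 ℕ.≤ n →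
              term q (suc n) ℚ.+ term q (suc n) ℚ.≤ term q n
term-halves q q≤1 n 1≤n = begin
  term q (suc n) ℚ.+ term q (suc n)              ≡⟨ ℚ.*-distribˡ-+ (q ^ℚ suc n) r r ⟨
  (q ^ℚ suc n) ℚ.* (r ℚ.+ r)                      ≤⟨ ℚ.*-monoˡ-≤-nonNeg (q ^ℚ suc n) {{^-nonNeg q (suc n)}} r+r≤ ⟩
  (q ^ℚ suc n) ℚ.* 1/ n !                         ≤⟨ ℚ.*-monoʳ-≤-nonNeg (1/ n !) {{1/!-nonNeg n}} decreasing ⟩
  term q n                                       ∎
  where
  open ℚ.≤-Reasoning
  r = 1/ suc n !
  r+r≤ : r ℚ.+ r ℚ.≤ 1/ n !
  r+r≤ = 2/a≤1/b (suc n !) (n !) {{suc n !≢0}} {{n !≢0}} (ℕ.+-monoʳ-≤ (n !) (ℕ.m≤n*m (n !) n {{ℕ.>-nonZero 1≤n}}))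
  decreasing : q ^ℚ suc n ℚ.≤ q ^ℚ n
  decreasing = ℚ.≤-trans (ℚ.*-monoʳ-≤-nonNeg (q ^ℚ n) {{^-nonNeg q n}} q≤1) (ℚ.≤-reflexive (ℚ.*-identityˡ (q ^ℚ n)))

-- From index 1 on the terms are at least halved, so the tail from N on is at
-- most twice the term N.
expSum-tail : ∀ q .{{_ : NonNegative q}} → q ℚ.≤ 1ℚ → ∀ N → 1 ℕ.≤ N → ∀ k →
              expSum q (k ℕ.+ N) ℚ.+ (term q (k ℕ.+ N) ℚ.+ term q (k ℕ.+ N)) ℚ.≤
              expSum q N ℚ.+ (term q N ℚ.+ term q N)
expSum-tail q q≤1 N 1≤N zero    = ℚ.≤-refl
expSum-tail q q≤1 N 1≤N (suc k) = begin
  (expSum q m ℚ.+ term q m) ℚ.+ (term q (suc m) ℚ.+ term q (suc m))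
    ≤⟨ ℚ.+-monoʳ-≤ (expSum q m ℚ.+ term q m) (term-halves q q≤1 m (ℕ.≤-trans 1≤N (ℕ.m≤n+m N k))) ⟩
  (expSum q m ℚ.+ term q m) ℚ.+ term q m    ≡⟨ ℚ.+-assoc (expSum q m) (term q m) (term q m) ⟩
  expSum q m ℚ.+ (term q m ℚ.+ term q m)    ≤⟨ expSum-tail q q≤1 N 1≤N k ⟩
  expSum q N ℚ.+ (term q N ℚ.+ term q N)    ∎
  where
  open ℚ.≤-Reasoning
  m = k ℕ.+ N

-- The strict limit inequality asks for one gap `ε` below all late partial sums; the bound on the
-- tail reduces this to one finite computation at N.
exp-<-tail : ∀ q .{{_ : NonNegative q}} → q ℚ.≤ 1ℚ → ∀ N → 1 ℕ.≤ N → ∀ ε → ε ℚ.> 0ℚ → ∀ {y} →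
             expSum q N ℚ.+ (term q N ℚ.+ term q N) ℚ.+ ε ℚ.≤ y → Lim expSum q < y
exp-<-tail q q≤1 N 1≤N ε ε>0 {y} bound = ε , ε>0 , N , λ n n≥N →
  subst (λ n → expSum q n ℚ.+ ε ℚ.≤ y) (ℕ.m∸n+n≡m n≥N) (below (n ℕ.∸ N))
  where
  below : ∀ k → expSum q (k ℕ.+ N) ℚ.+ ε ℚ.≤ y
  below k = ℚ.≤-trans (ℚ.+-monoˡ-≤ ε (ℚ.≤-trans
    (p≤p+q (expSum q (k ℕ.+ N)) (t ℚ.+ t) {{ℚ.nonNeg+nonNeg⇒nonNeg t {{t≥0}} t {{t≥0}}}})
    (expSum-tail q q≤1 N 1≤N k))) bound
    where
    t = term q (k ℕ.+ N)
    t≥0 = term-nonNeg q (k ℕ.+ N)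

-- One partial sum at `p` already reaches `y`, and partial sums grow with the argument and with the
-- length. Here `p` is a concrete number at which the sum can be evaluated, and `q` is arbitrary
-- above it.
exp-≮ : ∀ {p q} .{{_ : NonNegative p}} .{{_ : NonNegative q}} → p ℚ.≤ q → ∀ N {y} → y ℚ.≤ expSum p N → ¬ Lim expSum q < y
exp-≮ {p} {q} p≤q N {y} y≤ (ε , ε>0 , M , below) = ℚ.<-irrefl refl (begin-strict
  y                             ≡⟨ ℚ.+-identityʳ y ⟨
  y ℚ.+ 0ℚ                      <⟨ ℚ.+-monoʳ-< y ε>0 ⟩
  y ℚ.+ ε                       ≤⟨ ℚ.+-monoˡ-≤ ε y≤ ⟩
  expSum p N ℚ.+ ε              ≤⟨ ℚ.+-monoˡ-≤ ε (expSum-monoˡ p≤q N) ⟩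
  expSum q N ℚ.+ ε              ≤⟨ ℚ.+-monoˡ-≤ ε (expSum-monoʳ q N M) ⟩
  expSum q (M ℕ.+ N) ℚ.+ ε      ≤⟨ below (M ℕ.+ N) (ℕ.m≤m+n M N) ⟩
  y                             ∎)
  where open ℚ.≤-Reasoning

-- lo < log 2 < hi, both within 10⁻⁹ of log 2.
lo hi : ℚ
lo = + 25469 ℚ./ 36744
hi = + 32519 ℚ./ 46915

ceiling : IsCeiling (fromℕ (110 ℕ.* 9 ℕ.^ 7) · log (fromℕ 2)) (+ 364683163)
-- The product is about 364683162.48, and its factor 110·9⁷ exceeds 5·10⁸, so log 2 has to be known
-- to within about 10⁻⁹.
ceiling = (lo , lo<log2 , toWitness {a? = _ ℚ.≤? _} tt) , above
  where
  a = fromℕ (110 ℕ.* 9 ℕ.^ 7)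
  lo<log2 : log (fromℕ 2) lo
  lo<log2 = exp-<-tail lo (toWitness {a? = lo ℚ.≤? 1ℚ} tt) 12 (s≤s ℕ.z≤n) ε (toWitness {a? = 0ℚ ℚ.<? ε} tt)
    (toWitness {a? = expSum lo 12 ℚ.+ (term lo 12 ℚ.+ term lo 12) ℚ.+ ε ℚ.≤? fromℕ 2} tt)
    where ε = + 1 ℚ./ (10 ℕ.^ 10)
  above : ¬ (a · log (fromℕ 2)) (+ 364683163 ℚ./ 1)
  above (p , log2>p , N≤ap) = exp-≮ {hi} {p} {{_}} {{p≥0}} hi≤p 11
    (toWitness {a? = fromℕ 2 ℚ.≤? expSum hi 11} tt) log2>p
    where
    -- A smaller p would give a p < a hi ≤ 364683163, against the lower bound on a p.
    hi≤p : hi ℚ.≤ p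
    hi≤p = ℚ.≮⇒≥ λ p<hi → ℚ.<-irrefl refl (ℚ.<-≤-trans (ℚ.*-monoʳ-<-pos a p<hi)
      (ℚ.≤-trans (toWitness {a? = a ℚ.* hi ℚ.≤? + 364683163 ℚ./ 1} tt) N≤ap))
    p≥0 : NonNegative p
    p≥0 = ℚ.nonNegative (ℚ.≤-trans (toWitness {a? = 0ℚ ℚ.≤? hi} tt) hi≤p)

-- The book graphs

-- For `K₂₃` the number of colors that defeats every strategy is 5 + (6 + 1) = 12.
winning-≤11 : ∀ n q → Σ[ s ∈ Strategy (book 2 n) q ] Winning (book 2 n) s → q ≤ 11
winning-≤11 n q (s , wins) = ℕ.≮⇒≥ λ 11<q → ¬coverable⇒¬winning K₂₃ ¬coverable-K₂₃ 11<q s wins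

eventually⇒limit : ∀ {a l N} → (∀ n → n ≥ N → a n ≡ l) → IsLimit a l
eventually⇒limit {a} {l} {N} a≡l ε ε>0 = N , λ n n≥N → subst (ℚ._< ε)
  (sym (trans (cong (λ x → ℚ.∣ fromℕ x ℚ.- fromℕ l ∣) (a≡l n n≥N))
              (cong ℚ.∣_∣ (ℚ.+-inverseʳ (fromℕ l))))) ε>0

eventually⇒sup : ∀ {a l N} → (∀ n → n ≥ 1 → a n ≤ l) → (∀ n → n ≥ N → a n ≡ l) → IsSup≥1 a l
eventually⇒sup {N = N} a≤l a≡l = a≤l , λ b a≤b →
  -- The index N + 1 is at least N and also at least 1, even when N is 0.
  ℕ.≤-trans (ℕ.≤-reflexive (sym (a≡l (suc N) (ℕ.n≤1+n N)))) (a≤b (suc N) (s≤s z≤n))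

hgp-book : ∀ n → ∃[ h ] IsHGP (book 2 n) h
hgp-book n = hgp-exists (book 2 n) zero 11 (winning-≤11 n)

hgp-book-≤11 : ∀ n → proj₁ (hgp-book n) ≤ 11
hgp-book-≤11 n = winning-≤11 n _ (proj₁ (proj₂ (hgp-book n)))

hgp-book-≡11 : ∀ n → n ≥ 364683163 → proj₁ (hgp-book n) ≡ 11
hgp-book-≡11 n large = ℕ.≤-antisym (hgp-book-≤11 n) (proj₂ (proj₂ (hgp-book n)) 11 (winning-11 large))

theorem1p2 : IsC 2 11
    × IsCeiling (fromℕ (110 * 9 ^ 7) · log (fromℕ 2)) (+ 364683163)
    × (Σ[ hgp ∈ (ℕ → ℕ) ]
    (∀ n → IsHGP (book 2 n) (hgp n))
    × (∀ n → n ≥ 1 → hgp n ≤ 11)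
    × (∃[ n₀ ] (n₀ ≤ 364683163 × (∀ n → n ≥ n₀ → hgp n ≡ 11)))
    × IsLimit hgp 11
    × IsSup≥1 hgp 11)
theorem1p2 =
    C₂≡11
  , ceiling
  , proj₁ ∘ hgp-book
  , proj₂ ∘ hgp-book
  , (λ n _ → hgp-book-≤11 n)
  , (364683163 , ℕ.≤-refl , hgp-book-≡11)
  , eventually⇒limit hgp-book-≡11
  , eventually⇒sup (λ n _ → hgp-book-≤11 n) hgp-book-≡11
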